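{- For every integer $n\ge 1$, $$\mathrm{pf}_n(132,213,321)=\mathrm{pf}_n(132,312,321)=\mathrm{pf}_n(213,231,321)=\binom{2n-1}{n}.$$
   Context: A Dyck path of semilength $n$ is a lattice path from $(0,0)$ to $(n,n)$ consisting of $n$ north steps $N=(0,1)$ and $n$ east steps $E=(1,0)$ that never goes below the line $y=x$. A parking function of size $n$ is a Dyck path of semilength $n$ whose $n$ north steps are labeled bijectively by $\{1,\dots,n\}$ so that whenever two north steps are consecutive in the path (one immediately following the other), the label of the later one is larger. For a parking function $p$ of size $n$, $\phi(p)$ is the permutation of $\{1,\dots,n\}$ (in one-line notation) obtained by reading the labels of the north steps in the order they occur along the path. A permutation $\pi$ of $\{1,\dots,n\}$ contains a permutation $\rho$ of $\{1,\dots,m\}$ if there are indices $1\le i_1<\cdots<i_m\le n$ such that $\pi_{i_a}\le\pi_{i_b}$ if and only if $\rho_a\le\rho_b$; otherwise $\pi$ avoids $\rho$. For permutations $\rho_1,\dots,\rho_r$, $\mathrm{pf}_n(\rho_1,\dots,\rho_r)$ denotes the number of parking functions $p$ of size $n$ such that $\phi(p)$ avoids each of $\rho_1,\dots,\rho_r$. -}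

module Defs where

open import Data.Fin.Base as Fin using (Fin; toℕ)
import Data.Fin.Properties as Fin
open import Data.List.Base using (List; []; _∷_; [_]; map; length; lookup; inits; filter; allFin; cartesianProductWith)
open import Data.List.Membership.DecPropositional using (_∈?_)
open import Data.List.Membership.Propositional using (_∈_; lose)
open import Data.List.Membership.Propositional.Properties using (∈-map⁺; ∈-allFin; ∈-filter⁺; ∈-filter⁻; ∈-cartesianProductWith⁺)
open import Data.List.Relation.Unary.All as All using (All; []; _∷_)
import Data.List.Relation.Unary.All.Properties as All
open import Data.List.Relation.Unary.AllPairs using ([]; _∷_; allPairs?)
open import Data.List.Relation.Unary.Any using (here; there; any?; satisfied)
open import Data.List.Relation.Unary.Linked using (Linked; linked?)
open import Data.List.Relation.Unary.Unique.Propositional using (Unique)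
import Data.List.Relation.Unary.Unique.Propositional.Properties as Unique
open import Data.Nat.Base using (ℕ; zero; suc; _+_; _*_; _≤_)
open import Data.Nat.Properties using (_≟_; _≤?_; +-suc; +-identityʳ)
open import Data.Product.Base using (∃-syntax; _×_; _,_; proj₂)
open import Data.Unit.Base using (⊤; tt)
open import Data.Vec.Base as Vec using (Vec; []; _∷_)
import Data.Vec.Properties as Vec
open import Function.Base using (_∘_)
open import Function.Bundles using (_⇔_; mk⇔; Equivalence)
open import Relation.Binary.PropositionalEquality using (_≡_; refl; sym; trans; cong; cong₂; subst)
open import Relation.Nullary.Decidable using (Dec; yes; map′; _×-dec_; _→-dec_; ¬?)
open import Relation.Nullary.Negation using (¬_)
open import Relation.Unary using (Decidable)

-- A path carries the labels on its north steps.  The labels 1, …, n are represented by Fin n, with i standing for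
-- suc (toℕ i).

data Step (n : ℕ) : Set where
  north : (label : Fin n) → Step n
  east  : Step n

Path : ℕ → Set
Path n = List (Step n)

#N : ∀ {n} → Path n → ℕ
#N []            = 0
#N (north _ ∷ w) = suc (#N w)
#N (east    ∷ w) = #N w

#E : ∀ {n} → Path n → ℕ
#E []            = 0
#E (north _ ∷ w) = #E w
#E (east    ∷ w) = suc (#E w)

labels : ∀ {n} → Path n → List (Fin n)
labels []            = []
labels (north i ∷ w) = i ∷ labels w
labels (east    ∷ w) = labels w

-- The prefix u of a path ends at the lattice point (#E u , #N u).

NeverBelowDiagonal : ∀ {n} → Path n → Set
NeverBelowDiagonal w = All (λ u → #E u ≤ #N u) (inits w)

Ascending : ∀ {n} → Step n → Step n → Set
Ascending (north i) (north j) = i Fin.< j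
Ascending (north _) east      = ⊤
Ascending east      _         = ⊤

-- allUsed and distinct together say that the labelling is bijective.

record IsParkingFunction (n : ℕ) (w : Path n) : Set where
  field
    norths    : #N w ≡ n
    easts     : #E w ≡ n
    dyck      : NeverBelowDiagonal w
    distinct  : Unique (labels w)
    allUsed   : ∀ i → i ∈ labels w
    ascending : Linked Ascending w

φ : ∀ {n} → Path n → List ℕ
φ = map (suc ∘ toℕ) ∘ labels

StrictlyIncreasing : ∀ {m n} → Vec (Fin n) m → Set
StrictlyIncreasing is = ∀ a b → a Fin.< b → Vec.lookup is a Fin.< Vec.lookup is b

SameOrder : (π ρ : List ℕ) → Vec (Fin (length π)) (length ρ) → Set
SameOrder π ρ is = ∀ a b →
  lookup π (Vec.lookup is a) ≤ lookup π (Vec.lookup is b) ⇔ lookup ρ a ≤ lookup ρ b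

-- Permutations are given in one-line notation, with entries from 1.

infix 4 _Contains_ _Avoids_

_Contains_ : List ℕ → List ℕ → Set
π Contains ρ = ∃[ is ] StrictlyIncreasing is × SameOrder π ρ is

_Avoids_ : List ℕ → List ℕ → Set
π Avoids ρ = ¬ (π Contains ρ)

vectors : ∀ {A : Set} → List A → (k : ℕ) → List (Vec A k)
vectors xs zero    = [ [] ]
vectors xs (suc k) = cartesianProductWith _∷_ xs (vectors xs k)

∈-vectors : ∀ {A : Set} {xs : List A} → (∀ x → x ∈ xs) →
            ∀ {k} (v : Vec A k) → v ∈ vectors xs k
∈-vectors all∈ []      = here refl
∈-vectors all∈ (x ∷ v) = ∈-cartesianProductWith⁺ _∷_ (all∈ x) (∈-vectors all∈ v)

vectors-unique : ∀ {A : Set} {xs : List A} → Unique xs → ∀ k → Unique (vectors xs k)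
vectors-unique xs! zero    = [] ∷ []
vectors-unique xs! (suc k) =
  Unique.cartesianProductWith⁺ _∷_ Vec.∷-injective xs! (vectors-unique xs! k)

ascending? : ∀ {n} (s t : Step n) → Dec (Ascending s t)
ascending? (north i) (north j) = i Fin.<? j
ascending? (north _) east      = yes tt
ascending? east      _         = yes tt

isParkingFunction? : ∀ n → Decidable (IsParkingFunction n)
isParkingFunction? n w = map′
  (λ (p , q , r , s , t , u) → record
    { norths = p ; easts = q ; dyck = r ; distinct = s ; allUsed = t ; ascending = u })
  (λ p → let open IsParkingFunction p in
    norths , easts , dyck , distinct , allUsed , ascending)
  ( #N w ≟ n
  ×-dec #E w ≟ n
  ×-dec All.all? (λ u → #E u ≤? #N u) (inits w)
  ×-dec allPairs? (λ i j → ¬? (i Fin.≟ j)) (labels w)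
  ×-dec Fin.all? (λ i → _∈?_ Fin._≟_ i (labels w))
  ×-dec linked? ascending? w )

sameOrder? : ∀ π ρ → Decidable (SameOrder π ρ)
sameOrder? π ρ is = Fin.all? λ a → Fin.all? λ b →
  lookup π (Vec.lookup is a) ≤? lookup π (Vec.lookup is b) ⇔-dec lookup ρ a ≤? lookup ρ b
  where
  infix 3 _⇔-dec_
  _⇔-dec_ : ∀ {A B : Set} → Dec A → Dec B → Dec (A ⇔ B)
  a? ⇔-dec b? = map′ (λ (f , g) → mk⇔ f g) (λ e → Equivalence.to e , Equivalence.from e)
    ((a? →-dec b?) ×-dec (b? →-dec a?))

strictlyIncreasing? : ∀ {m n} → Decidable (StrictlyIncreasing {m} {n})
strictlyIncreasing? is = Fin.all? λ a → Fin.all? λ b →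
  (a Fin.<? b) →-dec (Vec.lookup is a Fin.<? Vec.lookup is b)

_contains?_ : ∀ π ρ → Dec (π Contains ρ)
π contains? ρ = map′ satisfied (λ (is , p) → lose (∈-vectors ∈-allFin is) p)
  (any? (λ is → strictlyIncreasing? is ×-dec sameOrder? π ρ is)
        (vectors (allFin (length π)) (length ρ)))

_avoids?_ : ∀ π ρ → Dec (π Avoids ρ)
π avoids? ρ = ¬? (π contains? ρ)

IsAvoidingPF : (n : ℕ) → List (List ℕ) → Path n → Set
IsAvoidingPF n ρs w = IsParkingFunction n w × All (φ w Avoids_) ρs

isAvoidingPF? : ∀ n ρs → Decidable (IsAvoidingPF n ρs)
isAvoidingPF? n ρs w = isParkingFunction? n w ×-dec All.all? (φ w avoids?_) ρs

allSteps : ∀ n → List (Step n)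
allSteps n = east ∷ map north (allFin n)

paths : ∀ n → List (Path n)
paths n = map Vec.toList (vectors (allSteps n) (2 * n))

avoidingPFs : ∀ n → List (List ℕ) → List (Path n)
avoidingPFs n ρs = filter (isAvoidingPF? n ρs) (paths n)

pf : ℕ → List (List ℕ) → ℕ
pf n ρs = length (avoidingPFs n ρs)

-- The list counted by pf contains exactly the parking functions of size
-- n avoiding ρs, each of them once: see ∈-avoidingPFs and avoidingPFs-unique.

∈-allSteps : ∀ {n} (s : Step n) → s ∈ allSteps n
∈-allSteps (north i) = there (∈-map⁺ north (∈-allFin i))
∈-allSteps east      = here refl

allSteps-unique : ∀ n → Unique (allSteps n)
allSteps-unique n =
  All.map⁺ (All.universal (λ _ ()) (allFin n)) ∷
  Unique.map⁺ (λ { refl → refl }) (Unique.allFin⁺ n)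

length-path : ∀ {n} (w : Path n) → length w ≡ #N w + #E w
length-path []            = refl
length-path (north _ ∷ w) = cong suc (length-path w)
length-path (east    ∷ w) = trans (cong suc (length-path w)) (sym (+-suc (#N w) (#E w)))

∈-paths : ∀ {n w} → IsParkingFunction n w → w ∈ paths n
∈-paths {n} {w} p = ∈-toList (Vec.fromList w) len (Vec.toList∘fromList w)
  where
  open IsParkingFunction p
  len : length w ≡ 2 * n
  len = trans (length-path w)
    (cong₂ _+_ norths (trans easts (sym (+-identityʳ n))))
  ∈-toList : ∀ {k} (v : Vec (Step n) k) → k ≡ 2 * n → Vec.toList v ≡ w → w ∈ paths n
  ∈-toList v refl eq = subst (_∈ paths n) eq (∈-map⁺ Vec.toList (∈-vectors ∈-allSteps v))

∈-avoidingPFs : ∀ {n ρs w} → w ∈ avoidingPFs n ρs ⇔ IsAvoidingPF n ρs w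
∈-avoidingPFs {n} {ρs} = mk⇔
  (λ w∈ → proj₂ (∈-filter⁻ (isAvoidingPF? n ρs) {xs = paths n} w∈))
  (λ (p , av) → ∈-filter⁺ (isAvoidingPF? n ρs) (∈-paths p) (p , av))

avoidingPFs-unique : ∀ n ρs → Unique (avoidingPFs n ρs)
avoidingPFs-unique n ρs = Unique.filter⁺ (isAvoidingPF? n ρs)
  (Unique.map⁺ (λ {u} {v} eq → trans (sym (Vec.cast-is-id refl u)) (Vec.toList-injective refl u v eq))
    (vectors-unique (allSteps-unique n) (2 * n)))

{-# OPTIONS --safe #-}

-- Each set of patterns forbids, of three labels with the pivot (the label 1, or n for the last set) among them, the wrong
-- order of the other two.  So an avoiding permutation xs v ys with pivot v has xs ys (or ys xs, for the first set)
-- increasing, and is determined by the position of v.  In each case the n permutations are the identity and, for each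
-- 0 < p < n, one whose only descent is after the first p labels.  A parking function with these labels is a Dyck path whose
-- p-th north step is followed by an east step; for p = n, the identity, this condition holds for every Dyck path.  Hence the
-- parking functions are counted by Dyck paths with a marked peak.  For paths starting at height h with m + 1 north steps
-- left, the number of marked peaks is (h + 1) C(2m + 1 + h, m), by induction along the first step and the ballot formula
-- C(2m + h, m) − C(2m + h, m − 1) for the number of paths with m north steps left.

module Submission where

open import Data.Bool.Base using (if_then_else_; true; false)
open import Data.Fin.Base as Fin using (Fin; zero; suc; toℕ; fromℕ; inject₁)
open import Data.Fin.Patterns using (0F; 1F; 2F)
import Data.Fin.Properties as Fin
open import Data.Fin.Relation.Unary.Top using (view; ‵fromℕ; ‵inj₁)
open import Data.List.Base using (List; []; _∷_; [_]; _++_; applyUpTo; map; length; inits; concat; lookup; take; drop; tabulate; allFin)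
open import Data.List.Membership.Propositional using (_∈_)
open import Data.List.Membership.Propositional.Properties using (∈-map⁺; ∈-map⁻; ∈-++⁺ˡ; ∈-++⁺ʳ; ∈-++⁻; ∈-allFin; ∈-applyUpTo⁺; ∈-applyUpTo⁻; ∈-concat⁺′; ∈-concat⁻′; ∈-∃++; ∈-tabulate⁺; ∈-lookup)
open import Data.List.Membership.Propositional.Properties.WithK using (unique∧set⇒bag)
open import Data.List.Properties using (applyUpTo-∷ʳ; length-map; length-++; length-tabulate; ∷-injectiveʳ; length-take; length-drop; take++drop≡id; tabulate-lookup)
open import Data.List.Relation.Binary.BagAndSetEquality using (∼bag⇒↭)
open import Data.List.Relation.Binary.Permutation.Propositional using (_↭_; prep; ↭-sym; ↭-trans; ↭-reflexive; ↭⇒↭ₛ)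
open import Data.List.Relation.Binary.Permutation.Propositional.Properties using (↭-length; ∈-resp-↭; shift; ++-comm)
import Data.List.Relation.Binary.Permutation.Setoid.Properties as Permutationₛ
open import Data.List.Relation.Unary.All as All using (All; []; _∷_)
import Data.List.Relation.Unary.All.Properties as All
open import Data.List.Relation.Unary.AllPairs as AllPairs using (AllPairs; []; _∷_)
import Data.List.Relation.Unary.AllPairs.Properties as AllPairs
open import Data.List.Relation.Unary.Any using (here; there)
open import Data.List.Relation.Unary.Linked as Linked using (Linked; []; [-]; _∷_)
open import Data.List.Relation.Unary.Unique.Propositional using (Unique)
import Data.List.Relation.Unary.Unique.Propositional.Properties as Unique
open import Data.Nat.Base
open import Data.Nat.Combinatorics using (_C_; nCk≡nC[n∸k]; nCk+nC[k+1]≡[n+1]C[k+1])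
open import Data.Nat.ListAction using (sum)
open import Data.Nat.ListAction.Properties using (sum-++)
open import Data.Nat.Properties
open import Data.Nat.Tactic.RingSolver using (solve-∀)
open import Data.Product.Base using (∃-syntax; _×_; _,_; proj₁; proj₂)
open import Data.Sum.Base using (_⊎_; inj₁; inj₂; [_,_]′)
open import Data.Unit.Base using (tt)
open import Data.Vec.Base using ([]; _∷_)
open import Defs
open import Function.Base using (_∘_)
open import Function.Bundles using (_⇔_; mk⇔; Equivalence)
open import Relation.Binary.PropositionalEquality hiding ([_])
open import Relation.Nullary.Decidable using (yes; no; does)
open import Relation.Nullary.Negation using (¬_; contradiction)
open import Relation.Nullary.Reflects using (ofʸ; ofⁿ)

open ≡-Reasoning

-- Counting marked peaks

-- ballot m h: the number of ways to finish a path from a point at height h above the diagonal when m north steps remain.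

ballot : ℕ → ℕ → ℕ
ballot zero    h       = 1
ballot (suc m) zero    = ballot m 1
ballot (suc m) (suc h) = ballot m (2 + h) + ballot (suc m) h

-- peaked p q h: the same with p + q north steps remaining, the p-th of which must be followed by an east step; for p = 0
-- the very next step must be east.

peaked : ℕ → ℕ → ℕ → ℕ
peaked zero    q zero    = 0
peaked zero    q (suc h) = ballot q h
peaked (suc p) q zero    = peaked p q 1
peaked (suc p) q (suc h) = peaked p q (2 + h) + peaked (suc p) q h

peaks : ℕ → ℕ → ℕ
peaks m h = sum (applyUpTo (λ p → peaked (suc p) (m ∸ suc p) h) m)

sum-applyUpTo-+ : ∀ (f g : ℕ → ℕ) n →
  sum (applyUpTo (λ i → f i + g i) n) ≡ sum (applyUpTo f n) + sum (applyUpTo g n)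
sum-applyUpTo-+ f g zero    = refl
sum-applyUpTo-+ f g (suc n) = trans
  (cong (f 0 + g 0 +_) (sum-applyUpTo-+ (λ i → f (suc i)) (λ i → g (suc i)) n))
  (interchange (f 0) (g 0) _ _)
  where
  interchange : ∀ a b c d → a + b + (c + d) ≡ a + c + (b + d)
  interchange = solve-∀

peaks-suc : ∀ m h → peaks (suc m) (suc h) ≡ (ballot m (suc h) + peaks m (2 + h)) + peaks (suc m) h
peaks-suc m h = sum-applyUpTo-+ (λ p → peaked p (m ∸ p) (2 + h)) (λ p → peaked (suc p) (m ∸ p) h) (suc m)

-- binom₋ n k is the binomial coefficient of n and k − 1, which vanishes at k = 0.

binom₋ : ℕ → ℕ → ℕ
binom₋ n zero    = 0
binom₋ n (suc k) = n C k

pascal : ∀ n k → binom₋ n k + n C k ≡ suc n C k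
pascal n zero    = refl
pascal n (suc k) = nCk+nC[k+1]≡[n+1]C[k+1] n k

central-symmetry : ∀ m → suc (m + m) C suc m ≡ suc (m + m) C m
central-symmetry m = trans (nCk≡nC[n∸k] (s≤s (m≤m+n m m))) (cong (suc (m + m) C_) (m+n∸m≡n m m))

ballot-binomial : ∀ m h → ballot m h + binom₋ (m + m + h) m ≡ (m + m + h) C m
ballot-binomial zero h = refl
ballot-binomial (suc m) zero = begin
  ballot m 1 + (suc m + suc m + 0) C m              ≡⟨ cong (λ N → ballot m 1 + N C m) size ⟩
  ballot m 1 + suc N C m                            ≡⟨ cong (ballot m 1 +_) (pascal N m) ⟨
  ballot m 1 + (binom₋ N m + N C m)                 ≡⟨ +-assoc (ballot m 1) _ _ ⟨
  (ballot m 1 + binom₋ N m) + N C m                 ≡⟨ cong (_+ N C m) ih ⟩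
  N C m + N C m                                     ≡⟨ cong (N C m +_) (central-symmetry m) ⟨
  N C m + N C suc m                                 ≡⟨ pascal N (suc m) ⟩
  suc N C suc m                                     ≡⟨ cong (_C suc m) size ⟨
  (suc m + suc m + 0) C suc m                       ∎
  where
  N = suc (m + m)
  size : suc m + suc m + 0 ≡ suc N
  size = trans (+-identityʳ _) (cong suc (+-suc m m))
  ih : ballot m 1 + binom₋ N m ≡ N C m
  ih = subst (λ N → ballot m 1 + binom₋ N m ≡ N C m) (+-comm (m + m) 1) (ballot-binomial m 1)
ballot-binomial (suc m) (suc h) = begin
  b₁ + b₂ + (suc m + suc m + suc h) C m             ≡⟨ cong (λ N → b₁ + b₂ + N C m) (+-suc (suc m + suc m) h) ⟩
  b₁ + b₂ + suc N C m                               ≡⟨ cong (b₁ + b₂ +_) (pascal N m) ⟨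
  b₁ + b₂ + (binom₋ N m + N C m)                    ≡⟨ interchange b₁ b₂ (binom₋ N m) (N C m) ⟩
  (b₁ + binom₋ N m) + (b₂ + N C m)                  ≡⟨ cong₂ _+_ ih (ballot-binomial (suc m) h) ⟩
  N C m + N C suc m                                 ≡⟨ pascal N (suc m) ⟩
  suc N C suc m                                     ≡⟨ cong (_C suc m) (+-suc (suc m + suc m) h) ⟨
  (suc m + suc m + suc h) C suc m                   ∎
  where
  N = suc m + suc m + h
  b₁ = ballot m (2 + h)
  b₂ = ballot (suc m) h
  size : ∀ m h → m + m + (2 + h) ≡ suc m + suc m + h
  size = solve-∀
  interchange : ∀ a b c d → a + b + (c + d) ≡ (a + c) + (b + d)
  interchange = solve-∀
  ih : b₁ + binom₋ N m ≡ N C m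
  ih = subst (λ N → b₁ + binom₋ N m ≡ N C m) (size m h) (ballot-binomial m (2 + h))

peaks-binomial : ∀ m h → peaks (suc m) h ≡ suc h * ((m + m + suc h) C m)
peaks-after-north : ∀ m h → peaks m (suc h) ≡ (2 + h) * binom₋ (m + m + h) m

peaks-after-north zero    h = sym (*-zeroʳ h)
peaks-after-north (suc m) h =
  trans (peaks-binomial m (suc h)) (cong (λ N → (2 + h) * (N C m)) (size m h))
  where
  size : ∀ m h → m + m + (2 + h) ≡ suc m + suc m + h
  size = solve-∀

peaks-binomial m zero = begin
  ballot m 0 + peaks m 1                            ≡⟨ cong (ballot m 0 +_) (peaks-after-north m 0) ⟩
  ballot m 0 + 2 * binom₋ N m                       ≡⟨ regroup (ballot m 0) (binom₋ N m) ⟩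
  binom₋ N m + (ballot m 0 + binom₋ N m)            ≡⟨ cong (binom₋ N m +_) (ballot-binomial m 0) ⟩
  binom₋ N m + N C m                                ≡⟨ pascal N m ⟩
  suc N C m                                         ≡⟨ cong (_C m) (+-suc (m + m) 0) ⟨
  (m + m + 1) C m                                   ≡⟨ *-identityˡ _ ⟨
  1 * ((m + m + 1) C m)                             ∎
  where
  N = m + m + 0
  regroup : ∀ b c → b + 2 * c ≡ c + (b + c)
  regroup = solve-∀
peaks-binomial m (suc h) = begin
  peaks (suc m) (suc h)                             ≡⟨ peaks-suc m h ⟩
  (b + peaks m (2 + h)) + peaks (suc m) h           ≡⟨ cong₂ (λ x y → b + x + y) (peaks-after-north m (suc h)) (peaks-binomial m h) ⟩
  (b + (3 + h) * binom₋ N m) + suc h * (N C m)      ≡⟨ regroup b (binom₋ N m) (N C m) h ⟩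
  (b + binom₋ N m) + ((2 + h) * binom₋ N m + suc h * (N C m))
    ≡⟨ cong (_+ ((2 + h) * binom₋ N m + suc h * (N C m))) (ballot-binomial m (suc h)) ⟩
  N C m + ((2 + h) * binom₋ N m + suc h * (N C m))  ≡⟨ collect (binom₋ N m) (N C m) h ⟩
  (2 + h) * (binom₋ N m + N C m)                    ≡⟨ cong ((2 + h) *_) (pascal N m) ⟩
  (2 + h) * (suc N C m)                             ≡⟨ cong (λ N → (2 + h) * (N C m)) (+-suc (m + m) (suc h)) ⟨
  (2 + h) * ((m + m + (2 + h)) C m)                 ∎
  where
  N = m + m + suc h
  b = ballot m (suc h)
  regroup : ∀ b c d h → (b + (3 + h) * c) + suc h * d ≡ (b + c) + ((2 + h) * c + suc h * d)
  regroup = solve-∀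
  collect : ∀ c d h → d + ((2 + h) * c + suc h * d) ≡ (2 + h) * (c + d)
  collect = solve-∀

peaks-central : ∀ n → n ≥ 1 → peaks n 0 ≡ (2 * n ∸ 1) C n
peaks-central (suc m) _ = begin
  peaks (suc m) 0                                   ≡⟨ peaks-binomial m 0 ⟩
  1 * ((m + m + 1) C m)                             ≡⟨ *-identityˡ _ ⟩
  (m + m + 1) C m                                   ≡⟨ cong (_C m) (+-comm (m + m) 1) ⟩
  suc (m + m) C m                                   ≡⟨ central-symmetry m ⟨
  suc (m + m) C suc m                               ≡⟨ cong (_C suc m) (size m) ⟩
  (2 * suc m ∸ 1) C suc m                           ∎
  where
  size : ∀ m → suc (m + m) ≡ m + suc (m + 0)
  size m = sym (trans (+-suc m (m + 0)) (cong (λ k → suc (m + k)) (+-identityʳ m)))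

-- Paths with prescribed labels

private variable
  A B : Set
  n h p : ℕ
  s : Step n
  l : List (Fin n)
  w : Path n

-- Completes s h l w: the path w is the rest of a parking function with remaining labels l, entered at height h above the
-- diagonal after the step s.  An east step s puts no condition on w, so it also serves as the start of a path.

data Completes {n} : Step n → ℕ → List (Fin n) → Path n → Set where
  done  : Completes s 0 [] []
  north : ∀ {i} → Ascending s (north i) → Completes (north i) (suc h) l w → Completes s h (i ∷ l) (north i ∷ w)
  east  : Completes east h l w → Completes s (suc h) l (east ∷ w)

ascending-east : (s : Step n) → Ascending s east
ascending-east (north _) = tt
ascending-east east      = tt

completes⇒labels : Completes s h l w → labels w ≡ l
completes⇒labels done        = refl
completes⇒labels (north _ c) = cong (_ ∷_) (completes⇒labels c)
completes⇒labels (east c)    = completes⇒labels c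

completes⇒ascending : Completes s h l w → Linked Ascending (s ∷ w)
completes⇒ascending done                = [-]
completes⇒ascending (north s<i c)       = s<i ∷ completes⇒ascending c
completes⇒ascending {s = s} (east c)    = ascending-east s ∷ completes⇒ascending c

completes⇒easts : Completes s h l w → #E w ≡ h + #N w
completes⇒easts done                = refl
completes⇒easts {h = h} (north _ c) = trans (completes⇒easts c) (sym (+-suc h _))
completes⇒easts (east c)            = cong suc (completes⇒easts c)

AboveFrom : ℕ → Path n → Set
AboveFrom h w = All (λ u → #E u ≤ h + #N u) (inits w)

aboveFrom-north : ∀ {i} → AboveFrom h (north i ∷ w) ⇔ AboveFrom (suc h) w
aboveFrom-north {h = h} {w = w} = mk⇔
  (λ { (_ ∷ p ∷ ps) → All.map (λ {u} → subst (#E u ≤_) (+-suc h (#N u))) (p ∷ All.map⁻ ps) })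
  (λ { (p ∷ ps) → z≤n ∷ subst (0 ≤_) (sym (+-suc h 0)) p ∷
         All.map⁺ (All.map (λ {u} → subst (#E u ≤_) (sym (+-suc h (#N u)))) ps) })

aboveFrom-east : AboveFrom (suc h) (east ∷ w) ⇔ AboveFrom h w
aboveFrom-east = mk⇔
  (λ { (_ ∷ p ∷ ps) → All.map s≤s⁻¹ (p ∷ All.map⁻ ps) })
  (λ { (p ∷ ps) → z≤n ∷ s≤s p ∷ All.map⁺ (All.map s≤s ps) })

completes⇒above : Completes s h l w → AboveFrom h w
completes⇒above done        = z≤n ∷ []
completes⇒above (north {w = w} _ c) = Equivalence.from (aboveFrom-north {w = w}) (completes⇒above c)
completes⇒above (east {w = w} c)    = Equivalence.from (aboveFrom-east {w = w}) (completes⇒above c)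

above⇒completes : ∀ h (w : Path n) → Linked Ascending (s ∷ w) → #E w ≡ h + #N w → AboveFrom h w →
                  Completes s h (labels w) w
above⇒completes zero    []            _         _   _           = done
above⇒completes h       (north i ∷ w) (s<i ∷ a) eq  above       =
  north s<i (above⇒completes (suc h) w a (trans eq (+-suc h _)) (Equivalence.to (aboveFrom-north {w = w}) above))
above⇒completes zero    (east ∷ w)    _         _   (_ ∷ () ∷ _)
above⇒completes (suc h) (east ∷ w)    (_ ∷ a)   eq  above       =
  east (above⇒completes h w a (suc-injective eq) (Equivalence.to (aboveFrom-east {w = w}) above))

labels-length : (w : Path n) → length (labels w) ≡ #N w
labels-length []            = refl
labels-length (north _ ∷ w) = cong suc (labels-length w)
labels-length (east ∷ w)    = labels-length w

Arrangement : List (Fin n) → Set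
Arrangement l = Unique l × ∀ i → i ∈ l

unique-length : ∀ {A : Set} {xs ys : List A} → Unique xs → Unique ys → (∀ {x} → x ∈ xs ⇔ x ∈ ys) →
                length xs ≡ length ys
unique-length xs! ys! same = ↭-length (∼bag⇒↭ (unique∧set⇒bag xs! ys! same))

arrangement-length : {l : List (Fin n)} → Arrangement l → length l ≡ n
arrangement-length {n} (l! , full) = trans
  (unique-length l! (Unique.allFin⁺ n) (mk⇔ (λ _ → ∈-allFin _) (λ _ → full _)))
  (length-tabulate (λ i → i))

parking⇔completes : {w : Path n} → IsParkingFunction n w ⇔ (Arrangement (labels w) × Completes east 0 (labels w) w)
parking⇔completes {n} {w} = mk⇔
  (λ p → let open IsParkingFunction p in
    (distinct , allUsed) , above⇒completes 0 w (after-east ascending) (trans easts (sym norths)) dyck)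
  (λ (arr , c) → let norths = trans (sym (labels-length w)) (arrangement-length arr) in record
    { norths = norths ; easts = trans (completes⇒easts c) norths ; dyck = completes⇒above c
    ; distinct = proj₁ arr ; allUsed = proj₂ arr ; ascending = Linked.tail (completes⇒ascending c) })
  where
  after-east : ∀ {w} → Linked Ascending w → Linked Ascending (east ∷ w)
  after-east []        = [-]
  after-east [-]       = tt ∷ [-]
  after-east (a ∷ as)  = tt ∷ a ∷ as

completions : Step n → ℕ → List (Fin n) → List (Path n)
northFirst : Step n → ℕ → List (Fin n) → List (Path n)
eastFirst : ℕ → List (Fin n) → List (Path n)
stopped : ℕ → List (Fin n) → List (Path n)

completions s h l = stopped h l ++ northFirst s h l ++ eastFirst h l

stopped zero    []      = [ [] ]
stopped zero    (_ ∷ _) = []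
stopped (suc _) _       = []

northFirst s h []      = []
northFirst s h (i ∷ l) =
  if does (ascending? s (north i)) then map (north i ∷_) (completions (north i) (suc h) l) else []

eastFirst zero    l = []
eastFirst (suc h) l = map (east ∷_) (completions east h l)

∈-northFirst⁺ : ∀ {i} → Ascending s (north i) → w ∈ completions (north i) (suc h) l →
                north i ∷ w ∈ northFirst s h (i ∷ l)
∈-northFirst⁺ {s = s} {i = i} s<i w∈ with ascending? s (north i)
... | yes _   = ∈-map⁺ _ w∈
... | no  s≮i = contradiction s<i s≮i

∈-northFirst⁻ : ∀ {i} → w ∈ northFirst s h (i ∷ l) →
                ∃[ v ] Ascending s (north i) × v ∈ completions (north i) (suc h) l × w ≡ north i ∷ v
∈-northFirst⁻ {s = s} {i = i} w∈ with ascending? s (north i)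
... | yes s<i = let v , v∈ , eq = ∈-map⁻ _ w∈ in v , s<i , v∈ , eq

∈-completions⁺ : Completes s h l w → w ∈ completions s h l
∈-completions⁺ done = here refl
∈-completions⁺ {s = s} (north {h = h} {l = l} {i = i} s<i c) =
  ∈-++⁺ʳ (stopped h (i ∷ l)) (∈-++⁺ˡ (∈-northFirst⁺ {h = h} {l = l} s<i (∈-completions⁺ c)))
∈-completions⁺ {s = s} {l = l} (east {h = h} c) = ∈-++⁺ʳ (northFirst s (suc h) l) (∈-map⁺ _ (∈-completions⁺ c))

∈-completions⁻ : ∀ (s : Step n) h l {w} → w ∈ completions s h l → Completes s h l w
∈-northFirst⇒completes : ∀ (s : Step n) h l {w} → w ∈ northFirst s h l → Completes s h l w
∈-eastFirst⇒completes : ∀ (s : Step n) h l {w} → w ∈ eastFirst h l → Completes s h l w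

∈-completions⁻ s h l w∈ with ∈-++⁻ (stopped h l) w∈
∈-completions⁻ s zero []      w∈ | inj₁ (here refl) = done
∈-completions⁻ s h    l       w∈ | inj₂ w∈′ =
  [ ∈-northFirst⇒completes s h l , ∈-eastFirst⇒completes s h l ]′ (∈-++⁻ (northFirst s h l) w∈′)

∈-northFirst⇒completes s h (i ∷ l) w∈ with v , s<i , v∈ , refl ← ∈-northFirst⁻ {s = s} {h = h} {l = l} w∈ =
  north s<i (∈-completions⁻ (north i) (suc h) l v∈)

∈-eastFirst⇒completes s (suc h) l w∈ with v , v∈ , refl ← ∈-map⁻ (east ∷_) w∈ =
  east (∈-completions⁻ east h l v∈)

completions-unique : ∀ (s : Step n) h l → Unique (completions s h l)
northFirst-unique : ∀ (s : Step n) h l → Unique (northFirst s h l)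
eastFirst-unique : ∀ h (l : List (Fin n)) → Unique (eastFirst h l)

completions-unique s zero    []      = [] ∷ []
completions-unique s (suc h) []      = eastFirst-unique (suc h) []
completions-unique s zero    (i ∷ l) = Unique.++⁺ (northFirst-unique s zero (i ∷ l)) [] λ ()
completions-unique s (suc h) (i ∷ l) =
  Unique.++⁺ (northFirst-unique s (suc h) (i ∷ l)) (eastFirst-unique (suc h) (i ∷ l)) disjoint
  where
  disjoint : ∀ {w} → ¬ (w ∈ northFirst s (suc h) (i ∷ l) × w ∈ eastFirst (suc h) (i ∷ l))
  disjoint (w∈ , w∈′) with _ , _ , _ , refl ← ∈-northFirst⁻ {s = s} {l = l} w∈ | () ← proj₂ (proj₂ (∈-map⁻ _ w∈′))

northFirst-unique s h []      = []
northFirst-unique s h (i ∷ l) with ascending? s (north i)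
... | yes _ = Unique.map⁺ ∷-injectiveʳ (completions-unique (north i) (suc h) l)
... | no  _ = []

eastFirst-unique zero    l = []
eastFirst-unique (suc h) l = Unique.map⁺ ∷-injectiveʳ (completions-unique east h l)

-- DescentAt p s l: read after the step s, the labels l ascend except for a descent right after the first p of them;
-- there is no descent at all if p is the length of l.

data DescentAt {n} : ℕ → Step n → List (Fin n) → Set where
  end     : DescentAt 0 s []
  descent : ∀ {i} → ¬ Ascending s (north i) → AllPairs Fin._<_ (i ∷ l) → DescentAt 0 s (i ∷ l)
  ascent  : ∀ {i} → Ascending s (north i) → DescentAt p (north i) l → DescentAt (suc p) s (i ∷ l)

descentAt-unique : ∀ {p q} → DescentAt p s l → DescentAt q s l → p ≡ q
descentAt-unique end           end           = refl
descentAt-unique (descent _ _) (descent _ _) = refl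
descentAt-unique (descent s≮i _) (ascent s<i _) = contradiction s<i s≮i
descentAt-unique (ascent s<i _) (descent s≮i _) = contradiction s<i s≮i
descentAt-unique (ascent _ d)  (ascent _ d′) = cong suc (descentAt-unique d d′)

northFirst-length : ∀ (s : Step n) h i l → Ascending s (north i) →
                    length (northFirst s h (i ∷ l)) ≡ length (completions (north i) (suc h) l)
northFirst-length s h i l s<i with ascending? s (north i)
... | yes _   = length-map _ (completions (north i) (suc h) l)
... | no  s≮i = contradiction s<i s≮i

northFirst-empty : ∀ (s : Step n) h i l → ¬ Ascending s (north i) → northFirst s h (i ∷ l) ≡ []
northFirst-empty s h i l s≮i with ascending? s (north i)
... | yes s<i = contradiction s<i s≮i
... | no  _   = refl

completions-length-zero : ∀ (s : Step n) i l → Ascending s (north i) →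
  length (completions s zero (i ∷ l)) ≡ length (completions (north i) 1 l)
completions-length-zero s i l s<i = trans
  (length-++ (northFirst s zero (i ∷ l)))
  (trans (+-identityʳ _) (northFirst-length s zero i l s<i))

completions-length-suc : ∀ (s : Step n) h i l → Ascending s (north i) →
  length (completions s (suc h) (i ∷ l)) ≡ length (completions (north i) (2 + h) l) + length (completions east h (i ∷ l))
completions-length-suc s h i l s<i = trans
  (length-++ (northFirst s (suc h) (i ∷ l)))
  (cong₂ _+_ (northFirst-length s (suc h) i l s<i) (length-map _ (completions east h (i ∷ l))))

ballot-count : ∀ (s : Step n) h l → All (Ascending s ∘ north) l → AllPairs Fin._<_ l →
               length (completions s h l) ≡ ballot (length l) h
ballot-count s zero    []      _         _          = refl
ballot-count s (suc h) []      _         _          =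
  trans (length-map _ (completions east h [])) (ballot-count east h [] [] [])
ballot-count s zero    (i ∷ l) (s<i ∷ _) (i< ∷ l<)  =
  trans (completions-length-zero s i l s<i) (ballot-count (north i) 1 l i< l<)
ballot-count s (suc h) (i ∷ l) (s<i ∷ _) (i< ∷ l<)  = trans
  (completions-length-suc s h i l s<i)
  (cong₂ _+_ (ballot-count (north i) (2 + h) l i< l<)
             (ballot-count east h (i ∷ l) (All.universal (λ _ → tt) (i ∷ l)) (i< ∷ l<)))

peaked-count : ∀ p (s : Step n) h l → DescentAt p s l → NonZero (p + h) →
               length (completions s h l) ≡ peaked p (length l ∸ p) h
peaked-count zero s (suc h) [] end _ =
  trans (length-map _ (completions east h [])) (ballot-count east h [] [] [])
peaked-count zero s (suc h) (i ∷ l) (descent s≮i l<) _ = begin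
  length (northFirst s (suc h) (i ∷ l) ++ eastFirst (suc h) (i ∷ l))
    ≡⟨ cong (λ ws → length (ws ++ eastFirst (suc h) (i ∷ l))) (northFirst-empty s (suc h) i l s≮i) ⟩
  length (eastFirst (suc h) (i ∷ l))                                  ≡⟨ length-map _ (completions east h (i ∷ l)) ⟩
  length (completions east h (i ∷ l))
    ≡⟨ ballot-count east h (i ∷ l) (All.universal (λ _ → tt) (i ∷ l)) l< ⟩
  ballot (length (i ∷ l)) h                                           ∎
peaked-count (suc p) s zero (i ∷ l) (ascent s<i d) _ =
  trans (completions-length-zero s i l s<i)
        (peaked-count p (north i) 1 l d (>-nonZero (subst (0 <_) (+-comm 1 p) z<s)))
peaked-count (suc p) s (suc h) (i ∷ l) (ascent s<i d) _ = trans
  (completions-length-suc s h i l s<i)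
  (cong₂ _+_ (peaked-count p (north i) (2 + h) l d (>-nonZero (subst (0 <_) (sym (+-suc p (suc h))) z<s)))
             (peaked-count (suc p) east h (i ∷ l) (ascent tt d) _))

length-concat-applyUpTo : ∀ {A : Set} (f : ℕ → List A) (g : ℕ → ℕ) n → (∀ {e} → e < n → length (f e) ≡ g e) →
  length (concat (applyUpTo f n)) ≡ sum (applyUpTo g n)
length-concat-applyUpTo f g zero    _  = refl
length-concat-applyUpTo f g (suc n) eq = trans (length-++ (f 0))
  (cong₂ _+_ (eq z<s) (length-concat-applyUpTo (f ∘ suc) (g ∘ suc) n (λ e<n → eq (s<s e<n))))

-- The avoiding permutations are σ e for e < n, and δ e is the position of the descent of σ e (n for the identity).

record Classification (n : ℕ) (ρs : List (List ℕ)) : Set where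
  field
    σ : ℕ → List (Fin n)
    δ : ℕ → ℕ
    arrangement : ∀ {e} → e < n → Arrangement (σ e)
    avoids      : ∀ {e} → e < n → All (map (suc ∘ Fin.toℕ) (σ e) Avoids_) ρs
    exhaustive  : ∀ {l} → Arrangement l → All (map (suc ∘ Fin.toℕ) l Avoids_) ρs → ∃[ e ] e < n × l ≡ σ e
    descentAt   : ∀ {e} → e < n → DescentAt (δ e) east (σ e)
    positive    : ∀ {e} → e < n → NonZero (δ e)
    injective   : ∀ {e f} → e < f → f < n → δ e ≢ δ f

pf-classified : ∀ {ρs} (cl : Classification n ρs) →
                pf n ρs ≡ sum (applyUpTo (λ e → peaked (Classification.δ cl e) (n ∸ Classification.δ cl e) 0) n)
pf-classified {n} {ρs} cl = trans
  (unique-length (avoidingPFs-unique n ρs) candidates-unique (mk⇔ avoiding⇒candidate candidate⇒avoiding))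
  (length-concat-applyUpTo _ _ n count)
  where
  open Classification cl
  family : ℕ → List (Path n)
  family e = completions east 0 (σ e)

  candidates : List (Path n)
  candidates = concat (applyUpTo family n)

  count : ∀ {e} → e < n → length (family e) ≡ peaked (δ e) (n ∸ δ e) 0
  count {e} e<n = subst (λ k → length (family e) ≡ peaked (δ e) (k ∸ δ e) 0) (arrangement-length (arrangement e<n))
    (peaked-count (δ e) east 0 (σ e) (descentAt e<n)
      (subst NonZero (sym (+-identityʳ (δ e))) (positive e<n)))

  candidates-unique : Unique candidates
  candidates-unique = Unique.concat⁺
    (All.applyUpTo⁺₁ family n (λ {e} _ → completions-unique east 0 (σ e)))
    (AllPairs.applyUpTo⁺₁ family n disjoint)
    where
    disjoint : ∀ {e f} → e < f → f < n → ∀ {w} → ¬ (w ∈ family e × w ∈ family f)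
    disjoint {e} {f} e<f f<n (w∈e , w∈f) = injective e<f f<n
      (descentAt-unique (descentAt (<-trans e<f f<n)) (subst (DescentAt _ east) (sym same) (descentAt f<n)))
      where
      same : σ e ≡ σ f
      same = trans (sym (completes⇒labels (∈-completions⁻ east 0 (σ e) w∈e)))
                   (completes⇒labels (∈-completions⁻ east 0 (σ f) w∈f))

  avoiding⇒candidate : ∀ {w} → w ∈ avoidingPFs n ρs → w ∈ candidates
  avoiding⇒candidate {w} w∈ =
    let p , av       = Equivalence.to (∈-avoidingPFs {n} {ρs}) w∈
        arr , c      = Equivalence.to parking⇔completes p
        e , e<n , eq = exhaustive arr av
    in ∈-concat⁺′ (∈-completions⁺ (subst (λ l → Completes east 0 l w) eq c)) (∈-applyUpTo⁺ family e<n)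

  candidate⇒avoiding : ∀ {w} → w ∈ candidates → w ∈ avoidingPFs n ρs
  candidate⇒avoiding {w} w∈ with ∈-concat⁻′ (applyUpTo family n) w∈
  ... | _ , w∈e , e∈ with e , e<n , refl ← ∈-applyUpTo⁻ family e∈
        with c ← ∈-completions⁻ east 0 (σ e) w∈e
        with lw≡ ← completes⇒labels c =
    Equivalence.from (∈-avoidingPFs {n} {ρs})
      ( Equivalence.from parking⇔completes
          ( subst Arrangement (sym lw≡) (arrangement e<n)
          , subst (λ l → Completes east 0 l w) (sym lw≡) c)
      , subst (λ l → All (map (suc ∘ Fin.toℕ) l Avoids_) ρs) (sym lw≡) (avoids e<n))

-- Patterns of length three

data AllTriples {A : Set} (R : A → A → A → Set) : List A → Set where
  []  : AllTriples R []
  _∷_ : ∀ {x xs} → AllPairs (R x) xs → AllTriples R xs → AllTriples R (x ∷ xs)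

allTriples-zip : ∀ {R S : A → A → A → Set} {xs} → AllTriples R xs → AllTriples S xs →
                 AllTriples (λ x y z → R x y z × S x y z) xs
allTriples-zip []       []       = []
allTriples-zip (p ∷ ps) (q ∷ qs) = AllPairs.zip (p , q) ∷ allTriples-zip ps qs

allTriples-map : ∀ {R S : A → A → A → Set} {xs} → (∀ {x y z} → R x y z → S x y z) → AllTriples R xs → AllTriples S xs
allTriples-map f []       = []
allTriples-map f (p ∷ ps) = AllPairs.map f p ∷ allTriples-map f ps

allTriples-map⁻ : ∀ {f : A → B} {R : B → B → B → Set} xs → AllTriples R (map f xs) →
                  AllTriples (λ x y z → R (f x) (f y) (f z)) xs
allTriples-map⁻ []       []       = []
allTriples-map⁻ (x ∷ xs) (p ∷ ps) = AllPairs.map⁻ p ∷ allTriples-map⁻ xs ps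

allTriples-map⁺ : ∀ {f : A → B} {R : B → B → B → Set} {xs} → AllTriples (λ x y z → R (f x) (f y) (f z)) xs →
                  AllTriples R (map f xs)
allTriples-map⁺ []       = []
allTriples-map⁺ (p ∷ ps) = AllPairs.map⁺ p ∷ allTriples-map⁺ ps

allPairs-conditional : ∀ {A : Set} {P : A → Set} {S T : A → A → Set} {xs} →
  (∀ {y z} → P y → P z → S y z → T y z) → All P xs → AllPairs S xs → AllPairs T xs
allPairs-conditional f []       []       = []
allPairs-conditional f (p ∷ ps) (s ∷ ss) =
  All.zipWith (λ (q , t) → f p q t) (ps , s) ∷ allPairs-conditional f ps ss

allTriples-pairs : ∀ {A : Set} {S : A → A → Set} {R : A → A → A → Set} {xs} →
  (∀ {x y z} → S x y → S x z → S y z → R x y z) → AllPairs S xs → AllTriples R xs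
allTriples-pairs f []       = []
allTriples-pairs f (p ∷ ps) = allPairs-conditional f p ps ∷ allTriples-pairs f ps

allTriples-++⁺ : ∀ {A : Set} {S Q : A → A → Set} {R : A → A → A → Set} {xs ys} →
  (∀ {x y z} → S x y → S x z → S y z → R x y z) →
  (∀ {x y z} → S x y → Q x z → Q y z → R x y z) →
  (∀ {x y z} → Q x y → Q x z → S y z → R x y z) →
  AllPairs S xs → All (λ x → All (Q x) ys) xs → AllPairs S ys → AllTriples R (xs ++ ys)
allTriples-++⁺ f g h []       []       ts = allTriples-pairs f ts
allTriples-++⁺ f g h (s ∷ ss) (q ∷ qs) ts =
  AllPairs.++⁺ (allPairs-conditional f s ss)
               (allPairs-conditional h q ts)
               (All.zipWith (λ (sxy , qy) → All.zipWith (λ (qx , qyz) → g sxy qx qyz) (q , qy)) (s , qs))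
  ∷ allTriples-++⁺ f g h ss qs ts

allPairs-pivot : ∀ {A : Set} {S : A → A → Set} xs {v ys} → AllPairs S (xs ++ v ∷ ys) → All (λ x → S x v) xs × All (S v) ys
allPairs-pivot []       (p ∷ _)  = [] , p
allPairs-pivot (x ∷ xs) (p ∷ ps) = let q , r = allPairs-pivot xs ps in All.head (All.++⁻ʳ xs p) ∷ q , r

allTriples-pivot : ∀ {A : Set} {R : A → A → A → Set} xs {v ys} → AllTriples R (xs ++ v ∷ ys) →
  AllPairs (λ x y → R x y v) xs × All (λ x → All (R x v) ys) xs × AllPairs (R v) ys
allTriples-pivot []       (p ∷ _)  = [] , [] , p
allTriples-pivot (x ∷ xs) (p ∷ ps) =
  let a , b , c = allTriples-pivot xs ps
      d , e     = allPairs-pivot xs p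
  in d ∷ a , e ∷ b , c

lookup-triples⁺ : ∀ {R : A → A → A → Set} xs →
  (∀ {i j k} → i Fin.< j → j Fin.< k → R (lookup xs i) (lookup xs j) (lookup xs k)) → AllTriples R xs
lookup-triples⁺ []       r = []
lookup-triples⁺ (x ∷ xs) r =
  subst (AllPairs _) (tabulate-lookup xs) (AllPairs.tabulate⁺-< (λ j<k → r {zero} z<s (s<s j<k)))
  ∷ lookup-triples⁺ xs (λ i<j j<k → r (s<s i<j) (s<s j<k))

lookup-pairs⁻ : ∀ {A : Set} {S : A → A → Set} {xs} → AllPairs S xs → ∀ {i j} → i Fin.< j → S (lookup xs i) (lookup xs j)
lookup-pairs⁻ (p ∷ _)  {zero}  {suc j} _   = All.lookup p (∈-lookup j)
lookup-pairs⁻ (_ ∷ ps) {suc i} {suc j} i<j = lookup-pairs⁻ ps (s<s⁻¹ i<j)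

lookup-triples⁻ : ∀ {A : Set} {R : A → A → A → Set} {xs} → AllTriples R xs →
                  ∀ {i j k} → i Fin.< j → j Fin.< k → R (lookup xs i) (lookup xs j) (lookup xs k)
lookup-triples⁻ (p ∷ _)  {zero}  {suc j} {suc k} _   j<k = lookup-pairs⁻ p (s<s⁻¹ j<k)
lookup-triples⁻ (_ ∷ ps) {suc i} {suc j} {suc k} i<j j<k = lookup-triples⁻ ps (s<s⁻¹ i<j) (s<s⁻¹ j<k)

-- For distinct r and s: x and y are in the same strict order as r and s.  On numerals r and s this computes to a single
-- inequality.

Ordered : ℕ → ℕ → ℕ → ℕ → Set
Ordered r s x y = if r <ᵇ s then x < y else y < x

Like : ℕ → ℕ → ℕ → ℕ → ℕ → ℕ → Set
Like r s t x y z = Ordered r s x y × Ordered r t x z × Ordered s t y z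

ordered⇒⇔ : ∀ r s {x y} → r ≢ s → Ordered r s x y → (x ≤ y ⇔ r ≤ s) × (y ≤ x ⇔ s ≤ r)
ordered⇒⇔ r s r≢s o with r <ᵇ s | <ᵇ-reflects-< r s
... | true  | ofʸ r<s = mk⇔ (λ _ → <⇒≤ r<s) (λ _ → <⇒≤ o)
                      , mk⇔ (λ y≤x → contradiction o (≤⇒≯ y≤x)) (λ s≤r → contradiction r<s (≤⇒≯ s≤r))
... | false | ofⁿ r≮s = mk⇔ (λ x≤y → contradiction o (≤⇒≯ x≤y)) (λ r≤s → contradiction (≤∧≢⇒< r≤s r≢s) r≮s)
                      , mk⇔ (λ _ → ≮⇒≥ r≮s) (λ _ → <⇒≤ o)

⇔⇒ordered : ∀ r s {x y} → r ≢ s → (x ≤ y ⇔ r ≤ s) → (y ≤ x ⇔ s ≤ r) → Ordered r s x y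
⇔⇒ordered r s r≢s up down with r <ᵇ s | <ᵇ-reflects-< r s
... | true  | ofʸ r<s = ≰⇒> (λ y≤x → ≤⇒≯ (Equivalence.to down y≤x) r<s)
... | false | ofⁿ r≮s = ≰⇒> (λ x≤y → r≮s (≤∧≢⇒< (Equivalence.to up x≤y) r≢s))

ordered-suc : ∀ r s {x y} → Ordered r s (suc x) (suc y) ⇔ Ordered r s x y
ordered-suc r s with r <ᵇ s
... | true  = mk⇔ s<s⁻¹ s<s
... | false = mk⇔ s<s⁻¹ s<s

module _ {r s t : ℕ} (r≢s : r ≢ s) (r≢t : r ≢ t) (s≢t : s ≢ t) where

  contains⁺ : ∀ π {i j k} → i Fin.< j → j Fin.< k → Like r s t (lookup π i) (lookup π j) (lookup π k) →
              π Contains (r ∷ s ∷ t ∷ [])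
  contains⁺ π {i} {j} {k} i<j j<k (rs , rt , st) = i ∷ j ∷ k ∷ [] , increasing , sameOrder
    where
    increasing : StrictlyIncreasing (i ∷ j ∷ k ∷ [])
    increasing 0F 1F _ = i<j
    increasing 0F 2F _ = Fin.<-trans {i = i} i<j j<k
    increasing 1F 2F _ = j<k
    increasing 1F 1F (s≤s ())
    increasing 2F 1F (s≤s ())
    increasing 2F 2F (s≤s (s≤s ()))
    self : ∀ {x a} → x ≤ x ⇔ a ≤ a
    self = mk⇔ (λ _ → ≤-refl) (λ _ → ≤-refl)
    sameOrder : SameOrder π (r ∷ s ∷ t ∷ []) (i ∷ j ∷ k ∷ [])
    sameOrder 0F 0F = self
    sameOrder 0F 1F = proj₁ (ordered⇒⇔ r s r≢s rs)
    sameOrder 0F 2F = proj₁ (ordered⇒⇔ r t r≢t rt)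
    sameOrder 1F 0F = proj₂ (ordered⇒⇔ r s r≢s rs)
    sameOrder 1F 1F = self
    sameOrder 1F 2F = proj₁ (ordered⇒⇔ s t s≢t st)
    sameOrder 2F 0F = proj₂ (ordered⇒⇔ r t r≢t rt)
    sameOrder 2F 1F = proj₂ (ordered⇒⇔ s t s≢t st)
    sameOrder 2F 2F = self

  contains⁻ : ∀ π → π Contains (r ∷ s ∷ t ∷ []) →
              ∃[ i ] ∃[ j ] ∃[ k ] i Fin.< j × j Fin.< k × Like r s t (lookup π i) (lookup π j) (lookup π k)
  contains⁻ π (i ∷ j ∷ k ∷ [] , increasing , same) =
    i , j , k , increasing 0F 1F z<s , increasing 1F 2F (s<s z<s) ,
    ⇔⇒ordered r s r≢s (same 0F 1F) (same 1F 0F) ,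
    ⇔⇒ordered r t r≢t (same 0F 2F) (same 2F 0F) ,
    ⇔⇒ordered s t s≢t (same 1F 2F) (same 2F 1F)

  Unlike : ℕ → ℕ → ℕ → Set
  Unlike x y z = ¬ Like r s t x y z

  unlike-suc : ∀ {x y z} → Unlike (suc x) (suc y) (suc z) ⇔ Unlike x y z
  unlike-suc = mk⇔
    (λ ¬like (rs , rt , st) → ¬like
      (Equivalence.from (ordered-suc r s) rs , Equivalence.from (ordered-suc r t) rt , Equivalence.from (ordered-suc s t) st))
    (λ ¬like (rs , rt , st) → ¬like
      (Equivalence.to (ordered-suc r s) rs , Equivalence.to (ordered-suc r t) rt , Equivalence.to (ordered-suc s t) st))

  avoids⇒allTriples : ∀ {l : List (Fin n)} → map (suc ∘ toℕ) l Avoids (r ∷ s ∷ t ∷ []) →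
                      AllTriples (λ x y z → Unlike (toℕ x) (toℕ y) (toℕ z)) l
  avoids⇒allTriples {l = l} av = allTriples-map (Equivalence.to unlike-suc) (allTriples-map⁻ l values)
    where
    values : AllTriples Unlike (map (suc ∘ toℕ) l)
    values = lookup-triples⁺ _ (λ i<j j<k like → av (contains⁺ (map (suc ∘ toℕ) l) i<j j<k like))

  allTriples⇒avoids : ∀ {l : List (Fin n)} → AllTriples (λ x y z → Unlike (toℕ x) (toℕ y) (toℕ z)) l →
                      map (suc ∘ toℕ) l Avoids (r ∷ s ∷ t ∷ [])
  allTriples⇒avoids {l = l} ts c =
    let i , j , k , i<j , j<k , like = contains⁻ (map (suc ∘ toℕ) l) c
    in lookup-triples⁻ values i<j j<k like
    where
    values : AllTriples Unlike (map (suc ∘ toℕ) l)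
    values = allTriples-map⁺ (allTriples-map (Equivalence.from unlike-suc) ts)

-- The avoiding permutations

arrangement-resp-↭ : ∀ {n} {l l′ : List (Fin n)} → l ↭ l′ → Arrangement l → Arrangement l′
arrangement-resp-↭ {n} p (l! , full) =
  Permutationₛ.Unique-resp-↭ (setoid (Fin n)) (↭⇒↭ₛ p) l! , λ i → ∈-resp-↭ p (full i)

ascending-≡ : ∀ {n} {xs ys : List (Fin n)} → AllPairs Fin._<_ xs → AllPairs Fin._<_ ys →
              (∀ {i} → i ∈ xs → i ∈ ys) → (∀ {i} → i ∈ ys → i ∈ xs) → xs ≡ ys
ascending-≡ {xs = []}     {[]}     _          _          _ _ = refl
ascending-≡ {xs = []}     {y ∷ ys} _          _          _ g with () ← g (here refl)
ascending-≡ {xs = x ∷ xs} {[]}     _          _          f _ with () ← f (here refl)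
ascending-≡ {n} {x ∷ xs} {y ∷ ys} (x< ∷ xs<) (y< ∷ ys<) f g with heads≡
  where
  heads≡ : x ≡ y
  heads≡ with f (here refl) | g (here refl)
  ... | here x≡y  | _         = x≡y
  ... | there _   | here y≡x  = sym y≡x
  ... | there x∈ys | there y∈xs = contradiction (All.lookup x< y∈xs) (<-asym (All.lookup y< x∈ys))
... | refl = cong (x ∷_) (ascending-≡ xs< ys< (tail x< f) (tail y< g))
  where
  tail : ∀ {zs ws} → All (x Fin.<_) zs → (∀ {i} → i ∈ x ∷ zs → i ∈ x ∷ ws) → ∀ {i} → i ∈ zs → i ∈ ws
  tail x<zs h i∈ with h (there i∈)
  ... | here refl = contradiction (All.lookup x<zs i∈) (Fin.<-irrefl refl)
  ... | there i∈′ = i∈′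

rest-unique : ∀ {n} {v : Fin n} {xs ys} → Arrangement (v ∷ xs) → Arrangement (v ∷ ys) →
              AllPairs Fin._<_ xs → AllPairs Fin._<_ ys → xs ≡ ys
rest-unique {v = v} vxs vys xs< ys< = ascending-≡ xs< ys< (transfer vxs vys) (transfer vys vxs)
  where
  transfer : ∀ {zs ws} → Arrangement (v ∷ zs) → Arrangement (v ∷ ws) → ∀ {i} → i ∈ zs → i ∈ ws
  transfer (v≢ ∷ _ , _) (_ , full) {i} i∈ with full i
  ... | here refl = contradiction refl (All.lookup v≢ i∈)
  ... | there i∈′ = i∈′

ordered-parts : ∀ {n} {v : Fin n} {R₁ R₂ R₃ : Fin n → Fin n → Fin n → Set} {Q : Fin n → Fin n → Set} xs {ys} →
  (∀ {x y} → x ≢ y → x ≢ v → y ≢ v → R₁ x y v → x Fin.< y) →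
  (∀ {x y} → x ≢ y → x ≢ v → y ≢ v → R₂ x v y → Q x y) →
  (∀ {x y} → x ≢ y → x ≢ v → y ≢ v → R₃ v x y → x Fin.< y) →
  Unique (xs ++ v ∷ ys) →
  AllTriples R₁ (xs ++ v ∷ ys) → AllTriples R₂ (xs ++ v ∷ ys) → AllTriples R₃ (xs ++ v ∷ ys) →
  AllPairs Fin._<_ xs × All (λ x → All (Q x) ys) xs × AllPairs Fin._<_ ys
ordered-parts {n} {v} xs {ys} f g h l! ts₁ ts₂ ts₃ =
  AllPairs.map (λ ((x≢y , x≢v , y≢v) , r) → f x≢y x≢v y≢v r) (proj₁ (pivot ts₁)) ,
  All.map (All.map (λ ((x≢v , x≢y , v≢y) , r) → g x≢y x≢v (v≢y ∘ sym) r)) (proj₁ (proj₂ (pivot ts₂))) ,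
  AllPairs.map (λ ((v≢x , v≢y , x≢y) , r) → h x≢y (v≢x ∘ sym) (v≢y ∘ sym) r) (proj₂ (proj₂ (pivot ts₃)))
  where
  Distinct : Fin n → Fin n → Fin n → Set
  Distinct x y z = x ≢ y × x ≢ z × y ≢ z
  pivot : ∀ {R : Fin n → Fin n → Fin n → Set} → AllTriples R (xs ++ v ∷ ys) → _
  pivot {R} ts = allTriples-pivot {R = λ x y z → Distinct x y z × R x y z} xs
    (allTriples-zip (allTriples-pairs (λ p q r → p , q , r) l!) ts)

≢∧≮⇒< : ∀ {n} {x y : Fin n} → x ≢ y → ¬ (y Fin.< x) → x Fin.< y
≢∧≮⇒< x≢y y≮x = Fin.≤∧≢⇒< (≮⇒≥ y≮x) x≢y

≢zero⇒positive : ∀ {n} {x : Fin (suc n)} → x ≢ zero → 0 < toℕ x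
≢zero⇒positive x≢0 = Fin.≤∧≢⇒< {i = zero} z≤n (x≢0 ∘ sym)

≢max⇒below : ∀ {n} {x : Fin (suc n)} → x ≢ fromℕ n → x Fin.< fromℕ n
≢max⇒below {x = x} x≢M = Fin.≤∧≢⇒< (Fin.≤fromℕ x) x≢M

take-length-++ : ∀ {A : Set} (xs ys : List A) → take (length xs) (xs ++ ys) ≡ xs
take-length-++ []       ys = refl
take-length-++ (x ∷ xs) ys = cong (x ∷_) (take-length-++ xs ys)

drop-length-++ : ∀ {A : Set} (xs ys : List A) → drop (length xs) (xs ++ ys) ≡ ys
drop-length-++ []       ys = refl
drop-length-++ (x ∷ xs) ys = drop-length-++ xs ys

take-drop-cross : ∀ {A : Set} {S : A → A → Set} {xs} k → AllPairs S xs → All (λ x → All (S x) (drop k xs)) (take k xs)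
take-drop-cross zero    _        = []
take-drop-cross (suc k) []       = []
take-drop-cross (suc k) (p ∷ ps) = All.drop⁺ k p ∷ take-drop-cross k ps

module Pivoted {m} (v : Fin (suc m)) (T : List (Fin (suc m)))
               (T< : AllPairs Fin._<_ T) (vT : Arrangement (v ∷ T)) where

  rest-length : length T ≡ m
  rest-length = suc-injective (arrangement-length vT)

  insert : ℕ → List (Fin (suc m))
  insert e = take e T ++ v ∷ drop e T

  insert-arrangement : ∀ e → Arrangement (insert e)
  insert-arrangement e = arrangement-resp-↭ (↭-sym (↭-trans
    (shift v (take e T) (drop e T))
    (↭-reflexive (cong (v ∷_) (take++drop≡id e T))))) vT

  insert-exhaustive : ∀ {l} → Arrangement l →
    (∀ xs ys → l ≡ xs ++ v ∷ ys → AllPairs Fin._<_ (xs ++ ys)) → ∃[ e ] e < suc m × l ≡ insert e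
  insert-exhaustive (l! , full) parts with xs , ys , refl ← ∈-∃++ (full v)
    with refl ← rest-unique vT (arrangement-resp-↭ (shift v xs ys) (l! , full)) T< (parts xs ys refl) =
    length xs ,
    s≤s (subst (length xs ≤_) (trans (sym (length-++ xs)) rest-length) (m≤m+n (length xs) (length ys))) ,
    cong₂ (λ as bs → as ++ v ∷ bs) (sym (take-length-++ xs ys)) (sym (drop-length-++ xs ys))

  OrderedOffPivot : Fin (suc m) → Fin (suc m) → Set
  OrderedOffPivot x y = x ≡ v ⊎ y ≡ v ⊎ x Fin.< y

  insert-ordered : ∀ e → AllPairs OrderedOffPivot (insert e)
  insert-ordered e = AllPairs.++⁺ (AllPairs.take⁺ e T≤) (All.universal (λ _ → inj₁ refl) _ ∷ AllPairs.drop⁺ e T≤)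
    (All.map (inj₂ (inj₁ refl) ∷_) (take-drop-cross e T≤))
    where
    T≤ : AllPairs OrderedOffPivot T
    T≤ = AllPairs.map (inj₂ ∘ inj₂) T<

  take-length : ∀ {e} → e < suc m → length (take e T) ≡ e
  take-length {e} (s≤s e≤m) = trans (length-take e T) (trans (cong (e ⊓_) rest-length) (m≤n⇒m⊓n≡m e≤m))

  rotate : ℕ → List (Fin (suc m))
  rotate e = drop (m ∸ e) T ++ v ∷ take (m ∸ e) T

  rotate-arrangement : ∀ e → Arrangement (rotate e)
  rotate-arrangement e = arrangement-resp-↭ (↭-sym (↭-trans
    (shift v (drop k T) (take k T))
    (prep v (↭-trans (++-comm (drop k T) (take k T)) (↭-reflexive (take++drop≡id k T)))))) vT
    where k = m ∸ e

  rotate-exhaustive : ∀ {l} → Arrangement l →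
    (∀ xs ys → l ≡ xs ++ v ∷ ys → AllPairs Fin._<_ (ys ++ xs)) → ∃[ e ] e < suc m × l ≡ rotate e
  rotate-exhaustive (l! , full) parts with xs , ys , refl ← ∈-∃++ (full v)
    with refl ← rest-unique vT (arrangement-resp-↭ (↭-trans (shift v xs ys) (prep v (++-comm xs ys))) (l! , full)) T< (parts xs ys refl) =
    length xs ,
    s≤s (subst (length xs ≤_) total (m≤n+m (length xs) (length ys))) ,
    cong₂ (λ as bs → as ++ v ∷ bs)
      (sym (trans (cong (λ k → drop k (ys ++ xs)) k≡) (drop-length-++ ys xs)))
      (sym (trans (cong (λ k → take k (ys ++ xs)) k≡) (take-length-++ ys xs)))
    where
    total : length ys + length xs ≡ m
    total = trans (sym (length-++ ys)) rest-length
    k≡ : m ∸ length xs ≡ length ys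
    k≡ = trans (cong (_∸ length xs) (sym total)) (m+n∸n≡m (length ys) (length xs))

  drop-length : ∀ {e} → e < suc m → length (drop (m ∸ e) T) ≡ e
  drop-length {e} (s≤s e≤m) = trans (length-drop (m ∸ e) T) (trans (cong (_∸ (m ∸ e)) rest-length) (m∸[m∸n]≡n e≤m))

ascending⇒descentAt : ∀ {n} {s : Step n} {l} → All (Ascending s ∘ north) l → AllPairs Fin._<_ l → DescentAt (length l) s l
ascending⇒descentAt []        []        = end
ascending⇒descentAt (s<i ∷ _) (i< ∷ l<) = ascent s<i (ascending⇒descentAt i< l<)

zero-descent : ∀ {m} {i : Fin (suc m)} {xs ys} → All (i Fin.<_) xs → AllPairs Fin._<_ xs →
               AllPairs Fin._<_ (zero ∷ ys) → DescentAt (length xs) (north i) (xs ++ zero ∷ ys)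
zero-descent []        []        0ys< = descent (λ ()) 0ys<
zero-descent (i<x ∷ _) (x< ∷ xs<) 0ys< = ascent i<x (zero-descent x< xs< 0ys<)

max-descent : ∀ {m} {s : Step (suc m)} {xs ys} → All (Ascending s ∘ north) xs → Ascending s (north (fromℕ m)) →
              All (Fin._< fromℕ m) xs → AllPairs Fin._<_ xs → AllPairs Fin._<_ ys →
              DescentAt (suc (length xs)) s (xs ++ fromℕ m ∷ ys)
max-descent [] s<M [] [] []           = ascent s<M end
max-descent [] s<M [] [] (y< ∷ ys<)   = ascent s<M (descent (≤⇒≯ (Fin.≤fromℕ _)) (y< ∷ ys<))
max-descent (s<x ∷ _) _ (x<M ∷ xs<M) (x< ∷ xs<) ys< = ascent s<x (max-descent x< x<M xs<M xs< ys<)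

-- With the minimum at index e > 0 the descent follows the first e labels; with the minimum in front there is none.

zeroDescent : ℕ → ℕ → ℕ
zeroDescent n zero    = n
zeroDescent n (suc e) = suc e

zeroDescent-correct : ∀ {m e} (xs : List (Fin (suc m))) {ys} → Arrangement (xs ++ zero ∷ ys) → length xs ≡ e →
  AllPairs Fin._<_ xs → AllPairs Fin._<_ (zero ∷ ys) → DescentAt (zeroDescent (suc m) e) east (xs ++ zero ∷ ys)
zeroDescent-correct []       {ys} arr refl _ 0ys< = subst (λ p → DescentAt p east (zero ∷ ys)) (arrangement-length arr)
  (ascending⇒descentAt (All.universal (λ _ → tt) _) 0ys<)
zeroDescent-correct (x ∷ xs) arr refl (x< ∷ xs<) 0ys< = ascent tt (zero-descent x< xs< 0ys<)

zeroDescent-nonZero : ∀ m e → NonZero (zeroDescent (suc m) e)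
zeroDescent-nonZero m zero    = _
zeroDescent-nonZero m (suc e) = _

zeroDescent-injective : ∀ {n e f} → e < f → f < n → zeroDescent n e ≢ zeroDescent n f
zeroDescent-injective {e = zero}  {suc f} _   f<n eq = <-irrefl (sym eq) f<n
zeroDescent-injective {e = suc e} {suc f} e<f _   eq = <-irrefl eq e<f

zeroDescent-sum : ∀ m → sum (applyUpTo (λ e → peaked (zeroDescent (suc m) e) (suc m ∸ zeroDescent (suc m) e) 0) (suc m))
                        ≡ peaks (suc m) 0
zeroDescent-sum m = begin
  g m + sum (applyUpTo g m)              ≡⟨ +-comm (g m) _ ⟩
  sum (applyUpTo g m) + g m              ≡⟨ cong (sum (applyUpTo g m) +_) (+-identityʳ (g m)) ⟨
  sum (applyUpTo g m) + sum [ g m ]      ≡⟨ sum-++ (applyUpTo g m) [ g m ] ⟨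
  sum (applyUpTo g m ++ [ g m ])         ≡⟨ cong sum (applyUpTo-∷ʳ g m) ⟩
  sum (applyUpTo g (suc m))              ∎
  where
  g : ℕ → ℕ
  g e = peaked (suc e) (m ∸ e) 0

module _ (m : ℕ) where

  private
    label< : AllPairs Fin._<_ (allFin (suc m))
    label< = AllPairs.tabulate⁺-< (λ i<j → i<j)

    zero-arrangement : Arrangement (zero ∷ tabulate {n = m} suc)
    zero-arrangement = Unique.allFin⁺ (suc m) , ∈-allFin

    max-arrangement : Arrangement (fromℕ m ∷ tabulate inject₁)
    max-arrangement =
      All.tabulate⁺ (λ _ → Fin.fromℕ≢inject₁) ∷ Unique.tabulate⁺ Fin.inject₁-injective , full
      where
      full : ∀ i → i ∈ fromℕ m ∷ tabulate inject₁
      full i with view i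
      ... | ‵fromℕ         = here refl
      ... | ‵inj₁ {i = j} _ = there (∈-tabulate⁺ j)

    below-max< : AllPairs Fin._<_ (tabulate {n = m} inject₁)
    below-max< = AllPairs.tabulate⁺-< (λ {i} {j} i<j → subst₂ _<_ (sym (Fin.toℕ-inject₁ i)) (sym (Fin.toℕ-inject₁ j)) i<j)

  module Low = Pivoted {m} zero (tabulate suc) (AllPairs.tail label<) zero-arrangement
  module High = Pivoted {m} (fromℕ m) (tabulate inject₁) below-max< max-arrangement

  classify-132-213-321 : Classification (suc m) ((1 ∷ 3 ∷ 2 ∷ []) ∷ (2 ∷ 1 ∷ 3 ∷ []) ∷ (3 ∷ 2 ∷ 1 ∷ []) ∷ [])
  classify-132-213-321 = record
    { σ = rotate
    ; δ = zeroDescent (suc m)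
    ; arrangement = λ {e} _ → rotate-arrangement e
    ; avoids = λ {e} _ →
          allTriples⇒avoids (λ ()) (λ ()) (λ ()) (triples e
            (λ _ _ y<z (_ , _ , z<y) → <-asym y<z z<y)
            (λ _ z<x _ (_ , x<z , _) → <-asym x<z z<x)
            (λ y<x _ _ (x<y , _ , _) → <-asym x<y y<x))
        ∷ allTriples⇒avoids (λ ()) (λ ()) (λ ()) (triples e
            (λ x<y _ _ (y<x , _ , _) → <-asym x<y y<x)
            (λ x<y _ _ (y<x , _ , _) → <-asym x<y y<x)
            (λ _ z<x _ (_ , x<z , _) → <-asym x<z z<x))
        ∷ allTriples⇒avoids (λ ()) (λ ()) (λ ()) (triples e
            (λ x<y _ _ (y<x , _ , _) → <-asym x<y y<x)
            (λ x<y _ _ (y<x , _ , _) → <-asym x<y y<x)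
            (λ _ _ y<z (_ , _ , z<y) → <-asym y<z z<y))
        ∷ []
    ; exhaustive = λ { arr@(l! , _) (av₁ ∷ av₂ ∷ av₃ ∷ []) → rotate-exhaustive arr λ { xs ys refl →
        let xs< , cross , ys< = ordered-parts xs
              (λ x≢y x≢0 y≢0 r → ≢∧≮⇒< x≢y (λ y<x → r (y<x , ≢zero⇒positive x≢0 , ≢zero⇒positive y≢0)))
              (λ x≢y x≢0 y≢0 r → ≢∧≮⇒< (x≢y ∘ sym) (λ x<y → r (≢zero⇒positive x≢0 , x<y , ≢zero⇒positive y≢0)))
              (λ x≢y x≢0 y≢0 r → ≢∧≮⇒< x≢y (λ y<x → r (≢zero⇒positive x≢0 , ≢zero⇒positive y≢0 , y<x)))
              l! (avoids⇒allTriples (λ ()) (λ ()) (λ ()) av₃)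
                 (avoids⇒allTriples (λ ()) (λ ()) (λ ()) av₂)
                 (avoids⇒allTriples (λ ()) (λ ()) (λ ()) av₁)
        in AllPairs.++⁺ ys< xs< (All.All-swap cross) } }
    ; descentAt = λ {e} e<n → zeroDescent-correct (drop (m ∸ e) rest) (rotate-arrangement e) (drop-length e<n)
        (AllPairs.drop⁺ (m ∸ e) (AllPairs.tail label<)) (AllPairs.take⁺ (suc (m ∸ e)) label<)
    ; positive = λ {e} _ → zeroDescent-nonZero m e
    ; injective = zeroDescent-injective
    }
    where
    open Low
    rest : List (Fin (suc m))
    rest = tabulate suc
    triples : ∀ {R : Fin (suc m) → Fin (suc m) → Fin (suc m) → Set} e →
      (∀ {x y z} → x Fin.< y → x Fin.< z → y Fin.< z → R x y z) →
      (∀ {x y z} → x Fin.< y → z Fin.< x → z Fin.< y → R x y z) →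
      (∀ {x y z} → y Fin.< x → z Fin.< x → y Fin.< z → R x y z) → AllTriples R (rotate e)
    triples e f g h = allTriples-++⁺ {Q = λ x y → y Fin.< x} f g h
      (AllPairs.drop⁺ (m ∸ e) (AllPairs.tail label<))
      (All.All-swap (take-drop-cross (suc (m ∸ e)) label<))
      (AllPairs.take⁺ (suc (m ∸ e)) label<)

  classify-132-312-321 : Classification (suc m) ((1 ∷ 3 ∷ 2 ∷ []) ∷ (3 ∷ 1 ∷ 2 ∷ []) ∷ (3 ∷ 2 ∷ 1 ∷ []) ∷ [])
  classify-132-312-321 = record
    { σ = insert
    ; δ = zeroDescent (suc m)
    ; arrangement = λ {e} _ → insert-arrangement e
    ; avoids = λ {e} _ →
          allTriples⇒avoids (λ ()) (λ ()) (λ ())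
            (allTriples-pairs (λ _ _ yz (_ , x<z , z<y) → no-descent yz z<y x<z) (insert-ordered e))
        ∷ allTriples⇒avoids (λ ()) (λ ()) (λ ())
            (allTriples-pairs (λ _ xz _ (_ , z<x , y<z) → no-descent xz z<x y<z) (insert-ordered e))
        ∷ allTriples⇒avoids (λ ()) (λ ()) (λ ())
            (allTriples-pairs (λ xy _ _ (y<x , _ , z<y) → no-descent xy y<x z<y) (insert-ordered e))
        ∷ []
    ; exhaustive = λ { arr@(l! , _) (av₁ ∷ av₂ ∷ av₃ ∷ []) → insert-exhaustive arr λ { xs ys refl →
        let xs< , cross , ys< = ordered-parts xs
              (λ x≢y x≢0 y≢0 r → ≢∧≮⇒< x≢y (λ y<x → r (y<x , ≢zero⇒positive x≢0 , ≢zero⇒positive y≢0)))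
              (λ x≢y x≢0 y≢0 r → ≢∧≮⇒< x≢y (λ y<x → r (≢zero⇒positive x≢0 , y<x , ≢zero⇒positive y≢0)))
              (λ x≢y x≢0 y≢0 r → ≢∧≮⇒< x≢y (λ y<x → r (≢zero⇒positive x≢0 , ≢zero⇒positive y≢0 , y<x)))
              l! (avoids⇒allTriples (λ ()) (λ ()) (λ ()) av₃)
                 (avoids⇒allTriples (λ ()) (λ ()) (λ ()) av₂)
                 (avoids⇒allTriples (λ ()) (λ ()) (λ ()) av₁)
        in AllPairs.++⁺ xs< ys< cross } }
    ; descentAt = λ {e} e<n → zeroDescent-correct (take e rest) (insert-arrangement e) (take-length e<n)
        (AllPairs.take⁺ e (AllPairs.tail label<))
        (All.drop⁺ e (AllPairs.head label<) ∷ AllPairs.drop⁺ e (AllPairs.tail label<))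
    ; positive = λ {e} _ → zeroDescent-nonZero m e
    ; injective = zeroDescent-injective
    }
    where
    open Low
    rest : List (Fin (suc m))
    rest = tabulate suc
    no-descent : ∀ {x y w} → OrderedOffPivot x y → y Fin.< x → ¬ (w Fin.< y)
    no-descent (inj₁ refl)        ()
    no-descent (inj₂ (inj₁ refl)) _   ()
    no-descent (inj₂ (inj₂ x<y))  y<x _ = <-asym x<y y<x

  classify-213-231-321 : Classification (suc m) ((2 ∷ 1 ∷ 3 ∷ []) ∷ (2 ∷ 3 ∷ 1 ∷ []) ∷ (3 ∷ 2 ∷ 1 ∷ []) ∷ [])
  classify-213-231-321 = record
    { σ = insert
    ; δ = suc
    ; arrangement = λ {e} _ → insert-arrangement e
    ; avoids = λ {e} _ →
          allTriples⇒avoids (λ ()) (λ ()) (λ ())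
            (allTriples-pairs (λ xy _ _ (y<x , x<z , _) → no-descent xy y<x x<z) (insert-ordered e))
        ∷ allTriples⇒avoids (λ ()) (λ ()) (λ ())
            (allTriples-pairs (λ _ xz _ (x<y , z<x , _) → no-descent xz z<x x<y) (insert-ordered e))
        ∷ allTriples⇒avoids (λ ()) (λ ()) (λ ())
            (allTriples-pairs (λ _ _ yz (y<x , _ , z<y) → no-descent yz z<y y<x) (insert-ordered e))
        ∷ []
    ; exhaustive = λ { arr@(l! , _) (av₁ ∷ av₂ ∷ av₃ ∷ []) → insert-exhaustive arr λ { xs ys refl →
        let xs< , cross , ys< = ordered-parts xs
              (λ x≢y x≢M y≢M r → ≢∧≮⇒< x≢y (λ y<x → r (y<x , ≢max⇒below x≢M , ≢max⇒below y≢M)))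
              (λ x≢y x≢M y≢M r → ≢∧≮⇒< x≢y (λ y<x → r (≢max⇒below x≢M , y<x , ≢max⇒below y≢M)))
              (λ x≢y x≢M y≢M r → ≢∧≮⇒< x≢y (λ y<x → r (≢max⇒below x≢M , ≢max⇒below y≢M , y<x)))
              l! (avoids⇒allTriples (λ ()) (λ ()) (λ ()) av₁)
                 (avoids⇒allTriples (λ ()) (λ ()) (λ ()) av₂)
                 (avoids⇒allTriples (λ ()) (λ ()) (λ ()) av₃)
        in AllPairs.++⁺ xs< ys< cross } }
    ; descentAt = λ {e} e<n → subst (λ k → DescentAt (suc k) east (insert e)) (take-length e<n)
        (max-descent (All.universal (λ _ → tt) _) tt
          (All.take⁺ e (All.tabulate⁺ (λ i → ≢max⇒below (Fin.fromℕ≢inject₁ ∘ sym))))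
          (AllPairs.take⁺ e below-max<) (AllPairs.drop⁺ e below-max<))
    ; positive = λ _ → _
    ; injective = λ e<f _ eq → <-irrefl (suc-injective eq) e<f
    }
    where
    open High
    no-descent : ∀ {x y w} → OrderedOffPivot x y → y Fin.< x → ¬ (x Fin.< w)
    no-descent {w = w} (inj₁ refl)        _   M<w = ≤⇒≯ (Fin.≤fromℕ w) M<w
    no-descent {x = x} (inj₂ (inj₁ refl)) M<x _   = ≤⇒≯ (Fin.≤fromℕ x) M<x
    no-descent (inj₂ (inj₂ x<y))  y<x _   = <-asym x<y y<x

theorem15 : ∀ (n : ℕ) → n ≥ 1 →
    let p132 = 1 ∷ 3 ∷ 2 ∷ []
        p213 = 2 ∷ 1 ∷ 3 ∷ []
        p231 = 2 ∷ 3 ∷ 1 ∷ []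
        p312 = 3 ∷ 1 ∷ 2 ∷ []
        p321 = 3 ∷ 2 ∷ 1 ∷ []
    in pf n (p132 ∷ p213 ∷ p321 ∷ []) ≡ pf n (p132 ∷ p312 ∷ p321 ∷ [])
     × pf n (p132 ∷ p312 ∷ p321 ∷ []) ≡ pf n (p213 ∷ p231 ∷ p321 ∷ [])
     × pf n (p213 ∷ p231 ∷ p321 ∷ []) ≡ (2 * n ∸ 1) C n
theorem15 (suc m) n≥1 = trans count₁ (sym count₂) , trans count₂ (sym count₃) , trans count₃ (peaks-central (suc m) n≥1)
  where
  count₁ = trans (pf-classified (classify-132-213-321 m)) (zeroDescent-sum m)
  count₂ = trans (pf-classified (classify-132-312-321 m)) (zeroDescent-sum m)
  count₃ = pf-classified (classify-213-231-321 m)
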